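{- Let $n\ge1$. The map $\vartheta$ on di-sk trees with $n$ nodes is an involution on $\mathfrak{DT}_n$ that preserves the number of $\ominus$-nodes and switches the two statistics $\mathsf{top}$ and $\mathsf{rpop}$; that is, for every $T\in\mathfrak{DT}_n$: $\vartheta(T)\in\mathfrak{DT}_n$, $\vartheta(\vartheta(T))=T$, $\mathsf{omi}(\vartheta(T))=\mathsf{omi}(T)$, $\mathsf{top}(\vartheta(T))=\mathsf{rpop}(T)$ and $\mathsf{rpop}(\vartheta(T))=\mathsf{top}(T)$. In particular it gives a bijective proof of $$\sum_{T\in\mathfrak{DT}_n}t^{\mathsf{omi}(T)}x^{\mathsf{top}(T)}y^{\mathsf{rpop}(T)}=\sum_{T\in\mathfrak{DT}_n}t^{\mathsf{omi}(T)}x^{\mathsf{rpop}(T)}y^{\mathsf{top}(T)}.$$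
   Context: A binary tree is a rooted tree in which each node has at most one left child and at most one right child. A di-sk tree is a binary tree whose nodes are labeled by $\oplus$ or $\ominus$ such that no node has the same label as its right child (right chain condition). $\mathfrak{DT}_n$ is the set of di-sk trees with $n$ nodes. The preorder visits, recursively, the parent, then its left subtree, then its right subtree. The reverse preorder visits, recursively, the right subtree, then the left subtree, then the parent. For a di-sk tree $T$: $\mathsf{top}(T)$ is the number of initial $\oplus$-nodes of $T$ under the preorder (i.e. the length of the maximal initial run of $\oplus$-nodes); $\mathsf{rpop}(T)$ is the number of initial $\oplus$-nodes of $T$ under the reverse preorder; $\mathsf{omi}(T)$ is the number of $\ominus$-nodes. The map $\vartheta$: let $v_i$ be the $i$-th node of $T$ under the preorder. Then $\vartheta(T)$ is the binary tree on the nodes $v_1,\dots,v_n$, each node keeping its label $\oplus$ or $\ominus$, with root $v_n$ and such that, for $i$ from $n-1$ down to $1$: if $v_i$ has right child $v_\ell$ in $T$, then $v_i$ is the right child of $v_\ell$ in $\vartheta(T)$; otherwise $v_i$ is the left child of $v_{i+1}$ in $\vartheta(T)$. -}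

module Defs where

open import Algebra.Bundles using (CommutativeSemiring)
open import Data.List.Base
  using (List; []; _∷_; [_]; _++_; length; filter; takeWhile; foldr; map; cartesianProductWith)
open import Data.List.Membership.Propositional using () renaming (_∈_ to _∈ₗ_)
open import Data.List.Membership.Propositional.Properties
  using (∈-cartesianProductWith⁺; ∈-cartesianProductWith⁻; ∈-filter⁺; ∈-filter⁻)
open import Data.List.Relation.Unary.All using ([]; _∷_; tabulate)
open import Data.List.Relation.Unary.AllPairs using ([]; _∷_)
open import Data.List.Relation.Unary.Any using (here; there)
open import Data.List.Relation.Unary.Unique.Propositional using (Unique)
import Data.List.Relation.Unary.Unique.Propositional.Properties as Unique
open import Data.Maybe.Base using (Maybe; just; nothing)
import Data.Maybe.Properties as Maybe
open import Data.Nat.Base using (ℕ; zero; suc; _+_; _≤_; s≤s⁻¹)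
open import Data.Nat.Properties using (≤-reflexive; ≤-trans; m≤m+n; m≤n+m; +-suc)
import Data.Nat.Properties as ℕ
open import Data.Product.Base using (_×_; _,_; proj₁; proj₂)
open import Data.Tree.Binary using (Tree; leaf; node; #nodes; mapₙ; module Prefix)
open import Data.Unit.Base using (⊤; tt)
open import Function.Base using (_∘_)
open import Function.Bundles using (_⇔_; mk⇔)
open import Level using (0ℓ)
open import Relation.Binary.Definitions using (DecidableEquality)
open import Relation.Binary.PropositionalEquality.Core using (_≡_; _≢_; refl; subst)
open import Relation.Nullary.Decidable using (yes; no; ¬?; _×-dec_)
open import Relation.Unary using (Pred; Decidable; _∈_)

data Label : Set where
  ⊕ ⊖ : Label

infix 4 _≟_
_≟_ : DecidableEquality Label
⊕ ≟ ⊕ = yes refl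
⊕ ≟ ⊖ = no λ ()
⊖ ≟ ⊕ = no λ ()
⊖ ≟ ⊖ = yes refl

-- A `leaf` stands for an absent child; the nodes of the tree are the `node`s.
BinTree : Set → Set
BinTree A = Tree A ⊤

root : ∀ {A} → BinTree A → Maybe A
root (leaf _)     = nothing
root (node _ a _) = just a

-- If the right child is absent, its root is `nothing` and the first
-- component holds trivially.
RightChain : Pred (BinTree Label) 0ℓ
RightChain (leaf _)     = ⊤
RightChain (node l s r) = just s ≢ root r × RightChain l × RightChain r

𝔇𝔗 : ℕ → Pred (BinTree Label) 0ℓ
𝔇𝔗 n T = #nodes T ≡ n × RightChain T

preorder : ∀ {A} → BinTree A → List A
preorder = Prefix.toList

reversePreorder : ∀ {A} → BinTree A → List A
reversePreorder (leaf _)     = []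
reversePreorder (node l a r) = reversePreorder r ++ reversePreorder l ++ [ a ]

initial⊕s : List Label → ℕ
initial⊕s = length ∘ takeWhile (_≟ ⊕)

top rpop omi : BinTree Label → ℕ
top  = initial⊕s ∘ preorder
rpop = initial⊕s ∘ reversePreorder
omi  = length ∘ filter (_≟ ⊖) ∘ preorder

-- (i , s) is the node vᵢ, carrying the label s.
Vertex : Set
Vertex = ℕ × Label

-- Names the nodes vₖ, vₖ₊₁, … in preorder.
number : ℕ → BinTree Label → BinTree Vertex
number k (leaf _)     = leaf tt
number k (node l s r) =
  node (number (suc k) l) (k , s) (number (suc k + #nodes l) r)

withRightChild : ∀ {A} → BinTree A → BinTree (A × Maybe A)
withRightChild (leaf _)     = leaf tt
withRightChild (node l a r) =
  node (withRightChild l) (a , root r) (withRightChild r)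

single : ∀ {A} → A → BinTree A
single a = node (leaf tt) a (leaf tt)

-- attachLeft w v t makes v the left child of w in t, and attachRight w v t
-- its right child; nodes are identified by their index.  An occupied slot
-- would be overwritten and an absent w would leave t unchanged, so an attachment
-- adds at most one node, and one that fails either way adds none.  Hence
-- ϑ(T) having as many nodes as T entails that neither ever happens.
attachLeft attachRight : Vertex → Vertex → BinTree Vertex → BinTree Vertex
attachLeft w v (leaf _) = leaf tt
attachLeft w v (node l u r) with proj₁ u ℕ.≟ proj₁ w
... | yes _ = node (single v) u r
... | no  _ = node (attachLeft w v l) u (attachLeft w v r)
attachRight w v (leaf _) = leaf tt
attachRight w v (node l u r) with proj₁ u ℕ.≟ proj₁ w
... | yes _ = node l u (single v)
... | no  _ = node (attachRight w v l) u (attachRight w v r)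

-- The argument lists v₁, …, vₙ, each with its right child in T.  The recursion
-- starts from the root vₙ and then places vₙ₋₁, …, v₁ in this order.
assemble : List (Vertex × Maybe Vertex) → BinTree Vertex
assemble []                                   = leaf tt
assemble ((v , _) ∷ [])                       = single v
assemble ((v , just w)  ∷ vs@(_ ∷ _))         = attachRight w v (assemble vs)
assemble ((v , nothing) ∷ vs@((v⁺ , _) ∷ _))  = attachLeft v⁺ v (assemble vs)

ϑ : BinTree Label → BinTree Label
ϑ T = mapₙ proj₂ (assemble (preorder (withRightChild (number 1 T))))

rightChain? : Decidable RightChain
rightChain? (leaf _)     = yes tt
rightChain? (node l s r) =
  ¬? (Maybe.≡-dec _≟_ (just s) (root r)) ×-dec rightChain? l ×-dec rightChain? r

𝔇𝔗? : ∀ n → Decidable (𝔇𝔗 n)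
𝔇𝔗? n T = #nodes T ℕ.≟ n ×-dec rightChain? T

graft : Label × BinTree Label → BinTree Label → BinTree Label
graft (s , l) r = node l s r

-- All labelled binary trees of height at most h.
trees : ℕ → List (BinTree Label)
trees zero    = [ leaf tt ]
trees (suc h) =
  leaf tt ∷ cartesianProductWith graft
              (cartesianProductWith _,_ (⊕ ∷ ⊖ ∷ []) (trees h)) (trees h)

-- A tree with n nodes has height at most n.
enum𝔇𝔗 : ℕ → List (BinTree Label)
enum𝔇𝔗 n = filter (𝔇𝔗? n) (trees n)

module _ {c ℓ} (R : CommutativeSemiring c ℓ) where
  open CommutativeSemiring R using (Carrier; 0#) renaming (_+_ to _⊞_)

  ∑𝔇𝔗 : ℕ → (BinTree Label → Carrier) → Carrier
  ∑𝔇𝔗 n f = foldr _⊞_ 0# (map f (enum𝔇𝔗 n))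

-- enum𝔇𝔗 n lists every element of 𝔇𝔗 n exactly once.

private
  labels-complete : ∀ s → s ∈ₗ ⊕ ∷ ⊖ ∷ []
  labels-complete ⊕ = here refl
  labels-complete ⊖ = there (here refl)

  trees-complete : ∀ h T → #nodes T ≤ h → T ∈ₗ trees h
  trees-complete zero    (leaf _)     _ = here refl
  trees-complete zero    (node l s r) p
    with () ← subst (_≤ 0) (+-suc (#nodes l) (#nodes r)) p
  trees-complete (suc h) (leaf _)     _ = here refl
  trees-complete (suc h) (node l s r) p =
    there (∈-cartesianProductWith⁺ graft
      (∈-cartesianProductWith⁺ _,_ (labels-complete s)
        (trees-complete h l (≤-trans (m≤m+n _ _) q)))
      (trees-complete h r (≤-trans (m≤n+m _ (#nodes l)) q)))
    where
    q : #nodes l + #nodes r ≤ h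
    q = s≤s⁻¹ (subst (_≤ suc h) (+-suc (#nodes l) (#nodes r)) p)

  trees-unique : ∀ h → Unique (trees h)
  trees-unique zero    = [] ∷ []
  trees-unique (suc h) =
    tabulate leaf∉ ∷
    Unique.cartesianProductWith⁺ graft (λ { refl → refl , refl })
      (Unique.cartesianProductWith⁺ _,_ (λ { refl → refl , refl })
        (((λ ()) ∷ []) ∷ [] ∷ []) (trees-unique h))
      (trees-unique h)
    where
    leaf∉ : ∀ {T} →
            T ∈ₗ cartesianProductWith graft
                   (cartesianProductWith _,_ (⊕ ∷ ⊖ ∷ []) (trees h)) (trees h) →
            leaf tt ≢ T
    leaf∉ T∈ refl
      with _ , _ , _ , _ , () ← ∈-cartesianProductWith⁻ graft
             (cartesianProductWith _,_ (⊕ ∷ ⊖ ∷ []) (trees h)) (trees h) T∈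

∈-enum𝔇𝔗 : ∀ n {T} → T ∈ₗ enum𝔇𝔗 n ⇔ T ∈ 𝔇𝔗 n
∈-enum𝔇𝔗 n {T} = mk⇔
  (λ T∈ → proj₂ (∈-filter⁻ (𝔇𝔗? n) {xs = trees n} T∈))
  (λ T∈ → ∈-filter⁺ (𝔇𝔗? n) (trees-complete n T (≤-reflexive (proj₁ T∈))) T∈)

enum𝔇𝔗-unique : ∀ n → Unique (enum𝔇𝔗 n)
enum𝔇𝔗-unique n = Unique.filter⁺ (𝔇𝔗? n) (trees-unique n)

{-# OPTIONS --safe #-}

-- Write θ T a b for ϑ T in which v₁, which is a leaf of ϑ T, has been given the
-- subtrees a and b.  Unfolding the placement of vₙ, …, v₁ yields the recursion
--   θ (node L v ∅) a b = θ L (node a v b) ∅,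
--   θ (node L v R) a b = θ R (ϑ L) (node a v b)   for R ≠ ∅.
-- Induction on T = node L v R then gives ϑ (θ T a b) = θ (node a v b) L R, which
-- for a = b = ∅ is ϑ (ϑ T) = T.  The order vₙ, …, v₁ is the preorder of ϑ T and
-- the reverse preorder of T, so ϑ exchanges top and rpop.  The identity of
-- generating functions is reindexing along ϑ.
module Submission where

open import Defs
open import Level using (Level)
open import Algebra.Bundles using (CommutativeSemiring)
open import Algebra.Definitions.RawSemiring using ()
open import Data.Nat.Base using (ℕ; _≤_)
open import Data.Product.Base using (_×_)
open import Relation.Binary.PropositionalEquality.Core using (_≡_)
open import Relation.Unary using (_∈_)

open import Data.List.Base using (List; []; _∷_; [_]; _++_; _ʳ++_; foldr; length; map)
open import Data.List.Membership.Propositional using () renaming (_∈_ to _∈ₗ_)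
open import Data.List.Membership.Propositional.Properties using (∈-map⁺; ∈-map⁻)
open import Data.List.Membership.Propositional.Properties.WithK using (unique∧set⇒bag)
open import Data.List.Properties using (++-assoc; ++-ʳ++; ++-identityʳ; map-∘; map-cong)
open import Data.List.Relation.Binary.BagAndSetEquality using (∼bag⇒↭)
open import Data.List.Relation.Binary.Permutation.Propositional using (_↭_; ↭-sym; ↭⇒↭ₛ′)
open import Data.List.Relation.Binary.Permutation.Propositional.Properties
  using (↭-length; ↭-reverse; filter-↭; map⁺)
import Data.List.Relation.Binary.Permutation.Setoid.Properties as Permutation
import Data.List.Relation.Unary.Unique.Propositional.Properties as Unique
open import Data.Maybe.Base using (Maybe; just; nothing)
open import Data.Nat.Base using (suc; _+_; _<_)
open import Data.Nat.Properties
  using (m+n≤o⇒m≤o; ≤-refl; <-≤-trans; <-trans; n<1+n; m≤m+n; m<n⇒m<1+n; >⇒≢)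
import Data.Nat.Properties as ℕ
open import Data.Nat.Tactic.RingSolver using (solve-∀)
open import Data.Product.Base using (_,_; proj₁; proj₂)
open import Data.Tree.Binary using (leaf; node; #nodes; mapₙ; module Prefix)
open import Data.Unit.Base using (tt)
open import Function.Base using (_∘_; id)
open import Function.Bundles using (mk⇔; Equivalence)
open import Relation.Binary.PropositionalEquality.Core
  using (_≢_; _≗_; refl; sym; trans; cong; cong₂; subst; subst₂)
open import Relation.Binary.PropositionalEquality.Properties using (module ≡-Reasoning)
open import Relation.Nullary.Decidable using (yes; no)
open import Relation.Nullary.Negation using (contradiction)

private
  variable
    A B : Set

∅ : BinTree A
∅ = leaf tt

-- The recursive description of ϑ

-- With the value a at ∅, the first equation of the recursion also covers L = ∅.
θ : BinTree A → BinTree A → BinTree A → BinTree A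
θ (leaf _)                  a b = a
θ (node l v (leaf _))       a b = θ l (node a v b) ∅
θ (node l v r@(node _ _ _)) a b = θ r (θ l ∅ ∅) (node a v b)

ϑ′ : BinTree A → BinTree A
ϑ′ T = θ T ∅ ∅

-- Arbitrary `a` and `b` are needed because each step of `θ` moves `v` into them. The induction
-- hypothesis at the root `w` of the next subtree then agrees with one unfolding of `θ` at `w` on
-- the right-hand side.
ϑ′-θ : ∀ l (v : A) r a b → ϑ′ (θ (node l v r) a b) ≡ θ (node a v b) l r
ϑ′-involutive : (T : BinTree A) → ϑ′ (ϑ′ T) ≡ T

ϑ′-θ (leaf _)       v (leaf _)       a b = refl
ϑ′-θ (node l₁ w l₂) v (leaf _)       a b = ϑ′-θ l₁ w l₂ (node a v b) ∅
ϑ′-θ l              v (node r₁ w r₂) a b = trans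
  (ϑ′-θ r₁ w r₂ (ϑ′ l) (node a v b))
  -- `ϑ′ l` now hangs to the left of `w`, so unfolding `θ` at `w` applies `ϑ′` to it a second time.
  (cong (λ l → θ (node a v b) l (node r₁ w r₂)) (ϑ′-involutive l))

ϑ′-involutive (leaf _)     = refl
ϑ′-involutive (node l v r) = ϑ′-θ l v r ∅ ∅

-- Naturality: `θ` inspects shapes only, never labels. This allows the indices to be forgotten after
-- assembly.
mapₙ-θ : (f : A → B) (T a b : BinTree A) →
         mapₙ f (θ T a b) ≡ θ (mapₙ f T) (mapₙ f a) (mapₙ f b)
mapₙ-θ f (leaf _)                  a b = refl
mapₙ-θ f (node l v (leaf _))       a b = mapₙ-θ f l (node a v b) ∅
mapₙ-θ f (node l v r@(node _ _ _)) a b = trans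
  (mapₙ-θ f r (ϑ′ l) (node a v b))
  (cong (λ c → θ (mapₙ f r) c (mapₙ f (node a v b))) (mapₙ-θ f l ∅ ∅))

-- The tree is nonempty here because `θ` of a leaf returns `a` and loses `b`. Otherwise the root `v`
-- is visited last, just before `a` and `b`.
preorder-θ : ∀ l (v : A) r a b xs →
  Prefix.toDiffList (θ (node l v r) a b) xs ≡
  reversePreorder (node l v r) ++ Prefix.toDiffList a (Prefix.toDiffList b xs)
preorder-ϑ′ : (T : BinTree A) (xs : List A) →
  Prefix.toDiffList (ϑ′ T) xs ≡ reversePreorder T ++ xs

preorder-θ (leaf _) v (leaf _) a b xs = refl
preorder-θ l@(node l₁ w l₂) v (leaf _) a b xs = trans
  (preorder-θ l₁ w l₂ (node a v b) ∅ xs)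
  (sym (++-assoc (reversePreorder l) [ v ] _))
preorder-θ l v r@(node r₁ w r₂) a b xs = begin
  Prefix.toDiffList (θ r (ϑ′ l) (node a v b)) xs
    ≡⟨ preorder-θ r₁ w r₂ (ϑ′ l) (node a v b) xs ⟩
  reversePreorder r ++ Prefix.toDiffList (ϑ′ l) (v ∷ ys)
    ≡⟨ cong (reversePreorder r ++_) (preorder-ϑ′ l (v ∷ ys)) ⟩
  reversePreorder r ++ reversePreorder l ++ v ∷ ys
    ≡⟨ cong (reversePreorder r ++_) (++-assoc (reversePreorder l) [ v ] ys) ⟨
  reversePreorder r ++ (reversePreorder l ++ [ v ]) ++ ys
    ≡⟨ ++-assoc (reversePreorder r) _ ys ⟨
  (reversePreorder r ++ reversePreorder l ++ [ v ]) ++ ys ∎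
  where
  open ≡-Reasoning
  ys = Prefix.toDiffList a (Prefix.toDiffList b xs)

preorder-ϑ′ (leaf _)     xs = refl
preorder-ϑ′ (node l v r) xs = preorder-θ l v r ∅ ∅ xs

-- A right edge from `v` to `w` turns into a right edge from `w` to `v`, and having different labels
-- is symmetric.
θ-rightChain : ∀ l v r a b → RightChain (node l v r) → RightChain (node a v b) →
               RightChain (θ (node l v r) a b)
ϑ′-rightChain : ∀ T → RightChain T → RightChain (ϑ′ T)

θ-rightChain (leaf _) v (leaf _) a b _ q = q
θ-rightChain (node l₁ w l₂) v (leaf _) a b (_ , p , _) q =
  θ-rightChain l₁ w l₂ (node a v b) ∅ p ((λ ()) , q , tt)
θ-rightChain l v (node r₁ w r₂) a b (v≢w , p , p′) q =
  θ-rightChain r₁ w r₂ (ϑ′ l) (node a v b) p′ (v≢w ∘ sym , ϑ′-rightChain l p , q)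

ϑ′-rightChain (leaf _)     _ = tt
ϑ′-rightChain (node l v r) p = θ-rightChain l v r ∅ ∅ p ((λ ()) , tt , tt)

-- Assembling the tree node by node

-- Indexing the two attachments by a side lets their common properties be proved once.
data Side : Set where
  left right : Side

attach : Side → Vertex → Vertex → BinTree Vertex → BinTree Vertex
attach left  = attachLeft
attach right = attachRight

attach-∅ : ∀ d w v → attach d w v ∅ ≡ ∅
attach-∅ left  w v = refl
attach-∅ right w v = refl

attach-skip : ∀ d w v l u r → proj₁ u ≢ proj₁ w →
  attach d w v (node l u r) ≡ node (attach d w v l) u (attach d w v r)
attach-skip left w v l u r u≢w with proj₁ u ℕ.≟ proj₁ w
... | yes u≡w = contradiction u≡w u≢w
... | no  _   = refl
attach-skip right w v l u r u≢w with proj₁ u ℕ.≟ proj₁ w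
... | yes u≡w = contradiction u≡w u≢w
... | no  _   = refl

attachLeft-root : ∀ w v l r → attachLeft w v (node l w r) ≡ node (single v) w r
attachLeft-root w v l r with proj₁ w ℕ.≟ proj₁ w
... | yes _  = refl
... | no w≢w = contradiction refl w≢w

attachRight-root : ∀ w v l r → attachRight w v (node l w r) ≡ node l w (single v)
attachRight-root w v l r with proj₁ w ℕ.≟ proj₁ w
... | yes _  = refl
... | no w≢w = contradiction refl w≢w

-- Vertices of `number k T` have index at least `k`, so `w` can be met only inside `a` or `b`.
attach-θ : ∀ d w v T k a b → proj₁ w < k →
  attach d w v (θ (number k T) a b) ≡ θ (number k T) (attach d w v a) (attach d w v b)
attach-ϑ′ : ∀ d w v T k → proj₁ w < k →
  attach d w v (ϑ′ (number k T)) ≡ ϑ′ (number k T)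

attach-θ d w v (leaf _) k a b w<k = refl
attach-θ d w v (node l s (leaf _)) k a b w<k = trans
  (attach-θ d w v l (suc k) (node a (k , s) b) ∅ (m<n⇒m<1+n w<k))
  (cong₂ (θ (number (suc k) l)) (attach-skip d w v a (k , s) b (>⇒≢ w<k)) (attach-∅ d w v))
attach-θ d w v (node l s r@(node _ _ _)) k a b w<k = trans
  (attach-θ d w v r _ (ϑ′ (number (suc k) l)) (node a (k , s) b)
    (<-≤-trans (m<n⇒m<1+n w<k) (m≤m+n (suc k) (#nodes l))))
  (cong₂ (θ (number (suc k + #nodes l) r))
    (attach-ϑ′ d w v l (suc k) (m<n⇒m<1+n w<k))
    (attach-skip d w v a (k , s) b (>⇒≢ w<k)))

attach-ϑ′ d w v T k w<k = trans
  (attach-θ d w v T k ∅ ∅ w<k)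
  (cong₂ (θ (number k T)) (attach-∅ d w v) (attach-∅ d w v))

-- One step of `θ` exposes `node a (k , s) b`, and the rest of the numbered tree has larger indices.
-- Taking the effect on this node as a premise serves both sides.
attach-root-θ : ∀ d v l s r k a b {a′ b′} →
  attach d (k , s) v (node a (k , s) b) ≡ node a′ (k , s) b′ →
  attach d (k , s) v (θ (number k (node l s r)) a b) ≡ θ (number k (node l s r)) a′ b′
attach-root-θ d v l s (leaf _) k a b eq = trans
  (attach-θ d (k , s) v l (suc k) (node a (k , s) b) ∅ (n<1+n k))
  (cong₂ (θ (number (suc k) l)) eq (attach-∅ d (k , s) v))
attach-root-θ d v l s r@(node _ _ _) k a b eq = trans
  (attach-θ d (k , s) v r _ (ϑ′ (number (suc k) l)) (node a (k , s) b)
    (m≤m+n (suc k) (#nodes l)))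
  (cong₂ (θ (number (suc k + #nodes l) r)) (attach-ϑ′ d (k , s) v l (suc k) (n<1+n k)) eq)

-- K t is the tree assembled from vs in which t sits in the free place for the
-- left child of the first vertex of vs (at the root if vs is empty); the other
-- vertices of K t have index at least m.
record Context (m : ℕ) (vs : List (Vertex × Maybe Vertex))
               (K : BinTree Vertex → BinTree Vertex) : Set where
  field
    assemble-vs   : assemble vs ≡ K ∅
    assemble-∷    : ∀ v → assemble ((v , nothing) ∷ vs) ≡ K (single v)
    attach-inside : ∀ d w v t → proj₁ w < m → attach d w v (K t) ≡ K (attach d w v t)

open Context

traverse : ℕ → BinTree Label → List (Vertex × Maybe Vertex) → List (Vertex × Maybe Vertex)
traverse k T = Prefix.toDiffList (withRightChild (number k T))

-- The case split only makes the tail visibly nonempty, so that `assemble` reduces.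
assemble-attachRight : ∀ w v k T u vs →
  assemble ((v , just w) ∷ traverse k T (u ∷ vs)) ≡
  attachRight w v (assemble (traverse k T (u ∷ vs)))
assemble-attachRight w v k (leaf _)     u vs = refl
assemble-attachRight w v k (node _ _ _) u vs = refl

#nodes-node : ∀ k l r → k + (l + suc r) ≡ suc k + l + r
#nodes-node = solve-∀

root-index : ∀ k l r {m} → k + (l + suc r) ≤ m → k < m
root-index k l r {m} p =
  m+n≤o⇒m≤o (suc k) (m+n≤o⇒m≤o (suc k + l) (subst (_≤ m) (#nodes-node k l r) p))

-- Once the tree is placed, the next free place is to the left of its root `(k , s)`, which is where
-- `θ` puts its argument `a`.
θ-context : ∀ l s r {k m vs K} → k + #nodes (node l s r) ≤ m → Context m vs K →
  assemble (traverse k (node l s r) vs) ≡ K (ϑ′ (number k (node l s r))) →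
  Context k (traverse k (node l s r) vs) (λ t → K (θ (number k (node l s r)) t ∅))
θ-context l s r {k} {m} {vs} {K} T≤m C T-assembled = record
  { assemble-vs   = T-assembled
  ; assemble-∷    = λ v → begin
      attachLeft (k , s) v (assemble (traverse k T vs))
        ≡⟨ cong (attachLeft (k , s) v) T-assembled ⟩
      attachLeft (k , s) v (K (ϑ′ (number k T)))
        ≡⟨ attach-inside C left (k , s) v _ k<m ⟩
      K (attachLeft (k , s) v (ϑ′ (number k T)))
        ≡⟨ cong K (attach-root-θ left v l s r k ∅ ∅ (attachLeft-root (k , s) v ∅ ∅)) ⟩
      K (θ (number k T) (single v) ∅) ∎
  ; attach-inside = λ d w v t w<k → trans
      (attach-inside C d w v _ (<-trans w<k k<m))
      (cong K (trans (attach-θ d w v T k t ∅ w<k)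
        (cong (θ (number k T) (attach d w v t)) (attach-∅ d w v))))
  }
  where
  open ≡-Reasoning
  T = node l s r
  k<m : k < m
  k<m = root-index k (#nodes l) (#nodes r) T≤m

assemble-traverse : ∀ T {k m vs K} → k + #nodes T ≤ m → Context m vs K →
                    assemble (traverse k T vs) ≡ K (ϑ′ (number k T))
assemble-traverse (leaf _) T≤m C = assemble-vs C
-- Without children, the next vertex in preorder lies outside the tree, so `(k , s)` fills the free
-- place of `K`.
assemble-traverse (node (leaf _) s (leaf _)) {k} T≤m C = assemble-∷ C (k , s)
assemble-traverse (node l@(node l₁ s′ l₂) s (leaf _)) {k} {m} T≤m C =
  assemble-∷ (θ-context l₁ s′ l₂ {suc k} l≤m C (assemble-traverse l l≤m C)) (k , s)
  where
  l≤m = subst (_≤ m) (trans (#nodes-node k (#nodes l) 0) (ℕ.+-identityʳ _)) T≤m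
assemble-traverse (node l s r@(node r₁ s′ r₂)) {k} {m} {vs} {K} T≤m C = begin
  assemble (traverse k (node l s r) vs)
    ≡⟨ assemble-attachRight w (k , s) (suc k) l (w , _) _ ⟩
  attachRight w (k , s) (assemble (traverse (suc k) l (traverse kᵣ r vs)))
    ≡⟨ cong (attachRight w (k , s))
         -- In the context left by `r`, the free place is to the left of `w`, so `l` lands there.
         -- Its indices stop just below `kᵣ`.
         (assemble-traverse l ≤-refl
           (θ-context r₁ s′ r₂ r≤m C (assemble-traverse r r≤m C))) ⟩
  attachRight w (k , s) (K (θ (number kᵣ r) l′ ∅))
    ≡⟨ attach-inside C right w (k , s) _ kᵣ<m ⟩
  K (attachRight w (k , s) (θ (number kᵣ r) l′ ∅))
    -- The right subtree of `w` is still empty, and `(k , s)` fills it.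
    ≡⟨ cong K (attach-root-θ right (k , s) r₁ s′ r₂ kᵣ l′ ∅ (attachRight-root w (k , s) l′ ∅)) ⟩
  K (θ (number kᵣ r) l′ (single (k , s))) ∎
  where
  open ≡-Reasoning
  kᵣ = suc k + #nodes l
  w = kᵣ , s′
  l′ = ϑ′ (number (suc k) l)
  r≤m = subst (_≤ m) (#nodes-node k (#nodes l) (#nodes r)) T≤m
  kᵣ<m : kᵣ < m
  kᵣ<m = root-index kᵣ (#nodes r₁) (#nodes r₂) r≤m

mapₙ-number : ∀ k T → mapₙ proj₂ (number k T) ≡ T
mapₙ-number k (leaf _)     = refl
mapₙ-number k (node l s r) = cong₂ (λ l r → node l s r) (mapₙ-number _ l) (mapₙ-number _ r)

ϑ≡ϑ′ : ∀ T → ϑ T ≡ ϑ′ T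
ϑ≡ϑ′ T = begin
  mapₙ proj₂ (assemble (traverse 1 T [])) ≡⟨ cong (mapₙ proj₂) (assemble-traverse T ≤-refl C) ⟩
  mapₙ proj₂ (ϑ′ (number 1 T))            ≡⟨ mapₙ-θ proj₂ (number 1 T) ∅ ∅ ⟩
  ϑ′ (mapₙ proj₂ (number 1 T))            ≡⟨ cong ϑ′ (mapₙ-number 1 T) ⟩
  ϑ′ T                                    ∎
  where
  open ≡-Reasoning
  -- Nothing is placed yet, so the free place is the root and the bound lies just past the last
  -- index.
  C : Context (1 + #nodes T) [] id
  C = record
    { assemble-vs   = refl
    ; assemble-∷    = λ _ → refl
    ; attach-inside = λ _ _ _ _ _ → refl
    }

-- Properties of ϑ

ϑ-involutive : ∀ T → ϑ (ϑ T) ≡ T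
ϑ-involutive T = trans (ϑ≡ϑ′ (ϑ T)) (trans (cong ϑ′ (ϑ≡ϑ′ T)) (ϑ′-involutive T))

ϑ-injective : ∀ {T U} → ϑ T ≡ ϑ U → T ≡ U
ϑ-injective {T} {U} eq = trans (sym (ϑ-involutive T)) (trans (cong ϑ eq) (ϑ-involutive U))

preorder-ϑ : ∀ T → preorder (ϑ T) ≡ reversePreorder T
preorder-ϑ T = trans (cong preorder (ϑ≡ϑ′ T)) (trans (preorder-ϑ′ T []) (++-identityʳ _))

-- The two traversals are exact reversals of each other, so they are permutations of one another.
preorder-reverse : (T : BinTree A) (xs : List A) →
                   Prefix.toDiffList T xs ≡ reversePreorder T ʳ++ xs
preorder-reverse (leaf _)     xs = refl
preorder-reverse (node l v r) xs = begin
  v ∷ Prefix.toDiffList l (Prefix.toDiffList r xs)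
    ≡⟨ cong (v ∷_) (preorder-reverse l _) ⟩
  v ∷ (reversePreorder l ʳ++ Prefix.toDiffList r xs)
    ≡⟨ cong (λ ys → v ∷ (reversePreorder l ʳ++ ys)) (preorder-reverse r xs) ⟩
  v ∷ (reversePreorder l ʳ++ reversePreorder r ʳ++ xs)
    ≡⟨ ++-ʳ++ (reversePreorder l) ⟨
  (reversePreorder l ++ [ v ]) ʳ++ (reversePreorder r ʳ++ xs)
    ≡⟨ ++-ʳ++ (reversePreorder r) ⟨
  (reversePreorder r ++ reversePreorder l ++ [ v ]) ʳ++ xs ∎
  where open ≡-Reasoning

length-preorder : (T : BinTree A) (xs : List A) →
                  length (Prefix.toDiffList T xs) ≡ #nodes T + length xs
length-preorder (leaf _)     xs = refl
length-preorder (node l v r) xs = begin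
  suc (length (Prefix.toDiffList l (Prefix.toDiffList r xs)))
    ≡⟨ cong suc (length-preorder l _) ⟩
  suc (#nodes l + length (Prefix.toDiffList r xs))
    ≡⟨ cong (λ n → suc (#nodes l + n)) (length-preorder r xs) ⟩
  suc (#nodes l + (#nodes r + length xs))
    ≡⟨ rearrange (#nodes l) (#nodes r) (length xs) ⟩
  #nodes l + suc (#nodes r) + length xs ∎
  where
  open ≡-Reasoning
  rearrange : ∀ l r n → suc (l + (r + n)) ≡ l + suc r + n
  rearrange = solve-∀

-- This single permutation yields both the node count and the number of `⊖`-nodes.
preorder-ϑ-↭ : ∀ T → preorder (ϑ T) ↭ preorder T
preorder-ϑ-↭ T = subst₂ _↭_ (sym (preorder-ϑ T)) (sym (preorder-reverse T []))
  (↭-sym (↭-reverse (reversePreorder T)))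

#nodes-ϑ : ∀ T → #nodes (ϑ T) ≡ #nodes T
#nodes-ϑ T = begin
  #nodes (ϑ T)            ≡⟨ length≡#nodes (ϑ T) ⟨
  length (preorder (ϑ T)) ≡⟨ ↭-length (preorder-ϑ-↭ T) ⟩
  length (preorder T)     ≡⟨ length≡#nodes T ⟩
  #nodes T                ∎
  where
  open ≡-Reasoning
  length≡#nodes : ∀ U → length (preorder U) ≡ #nodes U
  length≡#nodes U = trans (length-preorder U []) (ℕ.+-identityʳ _)

ϑ-𝔇𝔗 : ∀ {n T} → T ∈ 𝔇𝔗 n → ϑ T ∈ 𝔇𝔗 n
ϑ-𝔇𝔗 {n} {T} (T≡n , p) =
  trans (#nodes-ϑ T) T≡n , subst RightChain (sym (ϑ≡ϑ′ T)) (ϑ′-rightChain T p)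

omi-ϑ : ∀ T → omi (ϑ T) ≡ omi T
omi-ϑ T = ↭-length (filter-↭ (_≟ ⊖) (preorder-ϑ-↭ T))

top-ϑ : ∀ T → top (ϑ T) ≡ rpop T
top-ϑ T = cong initial⊕s (preorder-ϑ T)

rpop-ϑ : ∀ T → rpop (ϑ T) ≡ top T
rpop-ϑ T = trans (sym (top-ϑ (ϑ T))) (cong top (ϑ-involutive T))

-- Reindexing the generating function

enum𝔇𝔗-ϑ : ∀ n → enum𝔇𝔗 n ↭ map ϑ (enum𝔇𝔗 n)
-- Duplicate-free lists with the same elements are permutations of each other.
enum𝔇𝔗-ϑ n = ∼bag⇒↭ (unique∧set⇒bag
  (enum𝔇𝔗-unique n) (Unique.map⁺ ϑ-injective (enum𝔇𝔗-unique n)) (mk⇔ to from))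
  where
  closed : ∀ {T} → T ∈ₗ enum𝔇𝔗 n → ϑ T ∈ₗ enum𝔇𝔗 n
  closed = Equivalence.from (∈-enum𝔇𝔗 n) ∘ ϑ-𝔇𝔗 ∘ Equivalence.to (∈-enum𝔇𝔗 n)

  to : ∀ {T} → T ∈ₗ enum𝔇𝔗 n → T ∈ₗ map ϑ (enum𝔇𝔗 n)
  -- By involutivity, `ϑ T` is a preimage of `T`.
  to {T} T∈ = subst (_∈ₗ map ϑ (enum𝔇𝔗 n)) (ϑ-involutive T) (∈-map⁺ ϑ (closed T∈))

  from : ∀ {T} → T ∈ₗ map ϑ (enum𝔇𝔗 n) → T ∈ₗ enum𝔇𝔗 n
  from T∈ with _ , U∈ , refl ← ∈-map⁻ ϑ T∈ = closed U∈

module _ {c ℓ} (R : CommutativeSemiring c ℓ) where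
  open CommutativeSemiring R
    using (_≈_; 0#; setoid; isEquivalence; reflexive; +-isCommutativeMonoid)
    renaming (_+_ to _⊞_; trans to ≈-trans)

  -- Commutativity of addition lets the sum of `f` run over the permuted list `map ϑ (enum𝔇𝔗 n)`,
  -- whose terms are those of `g`.
  ∑𝔇𝔗-reindex : ∀ n {f g} → f ∘ ϑ ≗ g → ∑𝔇𝔗 R n f ≈ ∑𝔇𝔗 R n g
  ∑𝔇𝔗-reindex n {f} f∘ϑ≗g = ≈-trans
    (Permutation.foldr-commMonoid setoid +-isCommutativeMonoid
      (↭⇒↭ₛ′ isEquivalence (map⁺ f (enum𝔇𝔗-ϑ n))))
    (reflexive (cong (foldr _⊞_ 0#)
      (trans (sym (map-∘ (enum𝔇𝔗 n))) (map-cong f∘ϑ≗g (enum𝔇𝔗 n)))))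

mainTheorem6 : ∀ {c ℓ : Level} (n : ℕ) → 1 ≤ n →
    (∀ T → T ∈ 𝔇𝔗 n →
      (ϑ T ∈ 𝔇𝔗 n) ×
      (ϑ (ϑ T) ≡ T) ×
      (omi (ϑ T) ≡ omi T) ×
      (top (ϑ T) ≡ rpop T) ×
      (rpop (ϑ T) ≡ top T)) ×
    ((R : CommutativeSemiring c ℓ) →
      let open CommutativeSemiring R
          open Algebra.Definitions.RawSemiring rawSemiring using (_^_)
      in
      ∀ (t x y : Carrier) →
      ∑𝔇𝔗 R n (λ T → t ^ omi T * x ^ top T * y ^ rpop T) ≈
      ∑𝔇𝔗 R n (λ T → t ^ omi T * x ^ rpop T * y ^ top T))
mainTheorem6 n _ =
  (λ T T∈ → ϑ-𝔇𝔗 T∈ , ϑ-involutive T , omi-ϑ T , top-ϑ T , rpop-ϑ T) ,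
  λ R t x y →
    let open CommutativeSemiring R using (_*_; rawSemiring)
        open Algebra.Definitions.RawSemiring rawSemiring using (_^_)
    in ∑𝔇𝔗-reindex R n λ T → cong₂ _*_
         (cong₂ (λ i j → t ^ i * x ^ j) (omi-ϑ T) (top-ϑ T))
         (cong (y ^_) (rpop-ϑ T))
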